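{- Let $DL_n$ be the diagonal ladder. Then $\chi_g(DL_n)=8$ if $n\in\{5,6\}$, and $\chi_g(DL_n)=9$ if $n\geq 7$.
   Context: All graphs are finite, simple and connected. A graceful $k$-coloring of a non-empty graph $G$ ($k\geq 2$) is a proper vertex coloring $f:V(G)\to\{1,2,\dots,k\}$ such that the induced edge coloring $f^*(uv)=|f(u)-f(v)|$, with values in $\{1,\dots,k-1\}$, is a proper edge coloring. The graceful chromatic number $\chi_g(G)$ is the minimum such $k$. The diagonal ladder $DL_n$ ($n\geq 2$) has vertex set $\{x_i,y_i:1\leq i\leq n\}$ and edge set $\{x_ix_{i+1},\,y_iy_{i+1},\,x_iy_{i+1},\,y_ix_{i+1}:1\leq i\leq n-1\}\cup\{x_iy_i:1\leq i\leq n\}$ (i.e. $DL_n=P_n\boxtimes P_2$, the strong product). -}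

module Defs where

open import Data.Nat using (ℕ; suc; _≤_; _<_; ∣_-_∣)
open import Data.Fin using (Fin; toℕ)
open import Data.Product using (_×_; _,_; Σ)
open import Data.Sum using (_⊎_)
open import Relation.Binary.PropositionalEquality using (_≡_; _≢_)
open import Relation.Nullary using (¬_)

record Graph : Set₁ where
  field
    V   : Set
    Adj : V → V → Set

open Graph public

record IsGracefulColoring (G : Graph) (k : ℕ) (f : V G → ℕ) : Set where
  field
    range  : ∀ v → 1 ≤ f v × f v ≤ k
    proper : ∀ u v → Adj G u v → f u ≢ f v
    edgeProper : ∀ u v w → Adj G u v → Adj G u w → v ≢ w →
                 ∣ f u - f v ∣ ≢ ∣ f u - f w ∣

HasGracefulColoring : Graph → ℕ → Set
HasGracefulColoring G k = Σ (V G → ℕ) (IsGracefulColoring G k)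

GracefulChromaticNumber : Graph → ℕ → Set
GracefulChromaticNumber G k =
  2 ≤ k × HasGracefulColoring G k × (∀ j → j < k → ¬ HasGracefulColoring G j)

-- Diagonal ladder DL_n = P_n ⊠ P_2. Vertex (i , 0) is x_{i+1}, (i , 1) is y_{i+1}.
-- Edges: x_i y_i, and between any two vertices in consecutive rungs i, i+1.
DLAdj : (n : ℕ) → Fin n × Fin 2 → Fin n × Fin 2 → Set
DLAdj n (i , a) (j , b) =
  (toℕ j ≡ suc (toℕ i)) ⊎ (toℕ i ≡ suc (toℕ j)) ⊎ (i ≡ j × a ≢ b)

DL : ℕ → Graph
DL n = record { V = Fin n × Fin 2 ; Adj = DLAdj n }

{-# OPTIONS --safe #-}
-- A locally injective homomorphism pulls graceful colorings back.  So the upper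
-- bound for n ≥ 7 follows from a single graceful 9-coloring of C₄ ⊠ K₂, which
-- DL_n covers by reducing the rung index modulo 4, and the lower bounds reduce
-- to DL_5 (7 colors) and DL_7 (8 colors).  These two are refuted by exhaustive
-- search rung by rung; the constraints at the vertices of the inner rungs are
-- already contradictory.
module Submission where

open import Defs
open import Data.Empty using (⊥)
open import Data.Fin using (Fin; suc; toℕ; inject≤; opposite)
open import Data.Fin.Patterns using (0F; 1F; 2F; 3F)
open import Data.Fin.Properties using (toℕ-injective; toℕ-inject≤; inject≤-injective; opposite-involutive)
import Data.Fin.Properties as Fin
open import Data.List using (List; []; _∷_; map)
open import Data.List.Relation.Unary.All as All using (All; []; _∷_)
import Data.List.Relation.Unary.All.Properties as All
open import Data.List.Relation.Unary.AllPairs using ([]; _∷_)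
open import Data.List.Relation.Unary.Unique.Propositional using (Unique)
import Data.List.Relation.Unary.Unique.DecPropositional as DecUnique
open import Data.Nat using (ℕ; zero; suc; _+_; _≤_; _<_; z≤n; s≤s; s≤s⁻¹; ∣_-_∣; _≟_; _≤?_; _<?_)
open import Data.Nat.Properties using (suc-injective; ≤-refl; ≤-trans; m≤n⇒m<n∨m≡n; m≤n⇒m≤1+n; ≤∧≢⇒<; ≮⇒≥; ∣n-n∣≡0; ∣m-n∣≡0⇒m≡n)
open import Data.Product using (Σ; _×_; _,_; proj₁; proj₂)
open import Data.Product.Properties using (≡-dec)
open import Data.Sum using (_⊎_; inj₁; inj₂; [_,_]′)
open import Data.Vec using (Vec; []; _∷_; lookup)
open import Function using (_∘_)
open import Relation.Binary.Definitions using (DecidableEquality)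
open import Relation.Binary.PropositionalEquality using (_≡_; _≢_; refl; sym; trans; cong; cong₂)
open import Relation.Nullary using (¬_; Dec; yes; no; contradiction)
open import Relation.Nullary.Decidable using (True; toWitness; map′; from-yes; ¬?; _×-dec_; _⊎-dec_; _→-dec_)
open import Relation.Unary using (Decidable)

-- Locally injective homomorphisms.

record LocallyInjectiveHom (G H : Graph) : Set where
  field
    to        : V G → V H
    adj       : ∀ {u v} → Adj G u v → Adj H (to u) (to v)
    injective : ∀ {u v w} → Adj G u v → Adj G u w → v ≢ w → to v ≢ to w

-- `edgeProper` only compares two neighbors of one vertex, so injectivity on neighborhoods is enough
-- and the map itself may identify distant vertices.
pullback : ∀ {G H k} (h : LocallyInjectiveHom G H) (f : V H → ℕ) →
           IsGracefulColoring H k f → IsGracefulColoring G k (f ∘ LocallyInjectiveHom.to h)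
pullback h f c = record
  { range      = range ∘ to
  ; proper     = λ u v uv → proper (to u) (to v) (adj uv)
  ; edgeProper = λ u v w uv uw v≢w →
      edgeProper (to u) (to v) (to w) (adj uv) (adj uw) (injective uv uw v≢w)
  }
  where
  open LocallyInjectiveHom h
  open IsGracefulColoring c

weaken : ∀ {G j k} → j ≤ k → HasGracefulColoring G j → HasGracefulColoring G k
weaken j≤k (f , c) = f , record
  { range      = λ v → proj₁ (range v) , ≤-trans (proj₂ (range v)) j≤k
  ; proper     = proper
  ; edgeProper = edgeProper
  }
  where open IsGracefulColoring c

-- Maps between diagonal ladders.

_≟V_ : ∀ {n} → DecidableEquality (Fin n × Fin 2)
_≟V_ = ≡-dec Fin._≟_ Fin._≟_

DL-≤ : ∀ {m n} → m ≤ n → LocallyInjectiveHom (DL m) (DL n)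
DL-≤ {m} {n} m≤n = record
  { to        = λ (i , a) → inj i , a
  ; adj       = adj
  ; injective = λ _ _ v≢w eq →
      v≢w (cong₂ _,_ (inject≤-injective m≤n m≤n _ _ (cong proj₁ eq)) (cong proj₂ eq))
  }
  where
  inj : Fin m → Fin n
  inj i = inject≤ i m≤n

  up : ∀ i j → toℕ j ≡ suc (toℕ i) → toℕ (inj j) ≡ suc (toℕ (inj i))
  up i j eq = trans (toℕ-inject≤ j m≤n) (trans eq (cong suc (sym (toℕ-inject≤ i m≤n))))

  adj : ∀ {u v} → DLAdj m u v → DLAdj n (inj (proj₁ u) , proj₂ u) (inj (proj₁ v) , proj₂ v)
  adj {i , _} {j , _} (inj₁ eq)               = inj₁ (up i j eq)
  adj {i , _} {j , _} (inj₂ (inj₁ eq))        = inj₂ (inj₁ (up j i eq))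
  adj                 (inj₂ (inj₂ (eq , a≢b))) = inj₂ (inj₂ (cong inj eq , a≢b))

-- Pulling back along this map drops the first rung; it drives the induction in `stuck⇒¬coloring`.
DL-suc : ∀ n → LocallyInjectiveHom (DL n) (DL (suc n))
DL-suc n = record
  { to        = λ (i , a) → suc i , a
  ; adj       = λ where
      (inj₁ eq)                → inj₁ (cong suc eq)
      (inj₂ (inj₁ eq))         → inj₂ (inj₁ (cong suc eq))
      (inj₂ (inj₂ (eq , a≢b))) → inj₂ (inj₂ (cong suc eq , a≢b))
  ; injective = λ { _ _ v≢w refl → v≢w refl }
  }

DL-permute : ∀ {n} (π : Fin n → Fin 2 → Fin 2) → (∀ i {a b} → π i a ≡ π i b → a ≡ b) →
             LocallyInjectiveHom (DL n) (DL n)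
DL-permute π π-inj = record
  { to        = λ (i , a) → i , π i a
  ; adj       = λ where
      (inj₁ eq)                  → inj₁ eq
      (inj₂ (inj₁ eq))           → inj₂ (inj₁ eq)
      (inj₂ (inj₂ (refl , a≢b))) → inj₂ (inj₂ (refl , a≢b ∘ π-inj _))
  ; injective = λ _ _ v≢w eq → v≢w (to-injective eq)
  }
  where
  to-injective : ∀ {i j a b} → (i , π i a) ≡ (j , π j b) → (i , a) ≡ (j , b)
  -- The rungs are identified first, so that both sides involve the same `π i`.
  to-injective {i} eq with refl ← cong proj₁ eq = cong (i ,_) (π-inj i (cong proj₂ eq))

-- Sorting the colors within each rung.

Sorted : ∀ {n} → (Fin n × Fin 2 → ℕ) → Set
Sorted f = ∀ i → f (i , 0F) < f (i , 1F)

-- The two vertices of a rung are twins, so each rung may be swapped independently.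
sort : ∀ {n k} → HasGracefulColoring (DL n) k →
       Σ _ λ f → IsGracefulColoring (DL n) k f × Sorted f
sort {n} {k} (f , c) = _ , pullback (DL-permute π π-injective) f c , sorted
  where
  open IsGracefulColoring c

  orient : ∀ {x y : ℕ} → Dec (x < y) → Fin 2 → Fin 2
  orient (yes _) a = a
  orient (no  _) a = opposite a

  π : Fin n → Fin 2 → Fin 2
  π i = orient (f (i , 0F) <? f (i , 1F))

  π-injective : ∀ i {a b} → π i a ≡ π i b → a ≡ b
  π-injective i eq with f (i , 0F) <? f (i , 1F)
  ... | yes _ = eq
  ... | no  _ = trans (sym (opposite-involutive _)) (trans (cong opposite eq) (opposite-involutive _))

  sorted : ∀ i → f (i , π i 0F) < f (i , π i 1F)
  sorted i with f (i , 0F) <? f (i , 1F)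
  ... | yes lt = lt
  -- The ends of a rung are adjacent, so their colors differ and the swapped inequality is strict.
  ... | no  ≮  = ≤∧≢⇒< (≮⇒≥ ≮) (proper _ _ (inj₂ (inj₂ (refl , λ ()))))

-- Checking explicit colorings.

DLAdj? : ∀ {n} (u v : Fin n × Fin 2) → Dec (DLAdj n u v)
DLAdj? (i , a) (j , b) =
  (toℕ j ≟ suc (toℕ i)) ⊎-dec ((toℕ i ≟ suc (toℕ j)) ⊎-dec ((i Fin.≟ j) ×-dec ¬? (a Fin.≟ b)))

isGracefulColoring? : ∀ {m} (adj : Fin m × Fin 2 → Fin m × Fin 2 → Set) →
  (∀ u v → Dec (adj u v)) → ∀ k f →
  Dec (IsGracefulColoring (record { V = Fin m × Fin 2 ; Adj = adj }) k f)
isGracefulColoring? adj adj? k f = map′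
  (λ (r , p , e) → record { range = r ; proper = p ; edgeProper = e })
  (λ c → let open IsGracefulColoring c in range , proper , edgeProper)
  (∀V? (λ v → (1 ≤? f v) ×-dec (f v ≤? k)) ×-dec
   ∀V? (λ u → ∀V? λ v → adj? u v →-dec ¬? (f u ≟ f v)) ×-dec
   ∀V? (λ u → ∀V? λ v → ∀V? λ w → adj? u v →-dec (adj? u w →-dec
     (¬? (v ≟V w) →-dec ¬? (∣ f u - f v ∣ ≟ ∣ f u - f w ∣)))))
  where
  ∀V? : ∀ {m} {P : Fin m × Fin 2 → Set} → Decidable P → Dec (∀ v → P v)
  ∀V? P? = map′ (λ p (i , a) → p i a) (λ p i a → p (i , a))
    (Fin.all? λ i → Fin.all? λ a → P? (i , a))

fromRungs : ∀ {m} → Vec (Vec ℕ 2) m → Fin m × Fin 2 → ℕ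
fromRungs rs (i , a) = lookup (lookup rs i) a

DL₆-colorable : HasGracefulColoring (DL 6) 8
DL₆-colorable = f , from-yes (isGracefulColoring? (DLAdj 6) DLAdj? 8 f)
  where
  -- Up to order within rungs, reversing the ladder amounts to replacing each color `c` by `9 - c`.
  -- The first five rungs also serve for `DL 5`.
  f = fromRungs ((4 ∷ 5 ∷ []) ∷ (2 ∷ 7 ∷ []) ∷ (1 ∷ 6 ∷ []) ∷
                 (3 ∷ 8 ∷ []) ∷ (2 ∷ 7 ∷ []) ∷ (4 ∷ 5 ∷ []) ∷ [])

-- Nine colors for every diagonal ladder.

next : Fin 4 → Fin 4
next 0F = 1F
next 1F = 2F
next 2F = 3F
next 3F = 0F

C₄⊠K₂-Adj : Fin 4 × Fin 2 → Fin 4 × Fin 2 → Set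
C₄⊠K₂-Adj (i , a) (j , b) = (j ≡ next i) ⊎ (i ≡ next j) ⊎ (i ≡ j × a ≢ b)

C₄⊠K₂ : Graph
C₄⊠K₂ = record { V = Fin 4 × Fin 2 ; Adj = C₄⊠K₂-Adj }

C₄⊠K₂-colorable : HasGracefulColoring C₄⊠K₂ 9
C₄⊠K₂-colorable = f , from-yes (isGracefulColoring? C₄⊠K₂-Adj adj? 9 f)
  where
  adj? : ∀ u v → Dec (C₄⊠K₂-Adj u v)
  adj? (i , a) (j , b) =
    (j Fin.≟ next i) ⊎-dec ((i Fin.≟ next j) ⊎-dec ((i Fin.≟ j) ×-dec ¬? (a Fin.≟ b)))

  -- Rungs alternate between colors 1 to 4 and 6 to 9. The neighbors of a vertex in other rungs thus
  -- lie all above or all below its color, at distinct distances; as 5 is skipped, these are at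
  -- least 2, while the edge within a rung has 1.
  f = fromRungs ((1 ∷ 2 ∷ []) ∷ (6 ∷ 7 ∷ []) ∷ (3 ∷ 4 ∷ []) ∷ (8 ∷ 9 ∷ []) ∷ [])

-- The recursion makes a step to the following rung equal to `next` by definition.
mod₄ : ℕ → Fin 4
mod₄ zero    = 0F
mod₄ (suc n) = next (mod₄ n)

-- The closed neighborhood of a vertex lies in at most three consecutive rungs, whose residues are
-- distinct by `next≢` and `next²≢`; within a rung the second coordinate is kept.
DL-cover : ∀ n → LocallyInjectiveHom (DL n) C₄⊠K₂
DL-cover n = record { to = to ; adj = adj ; injective = injective }
  where
  to : Fin n × Fin 2 → Fin 4 × Fin 2
  to (i , a) = mod₄ (toℕ i) , a

  adj : ∀ {u v} → DLAdj n u v → C₄⊠K₂-Adj (to u) (to v)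
  adj (inj₁ eq)                = inj₁ (cong mod₄ eq)
  adj (inj₂ (inj₁ eq))         = inj₂ (inj₁ (cong mod₄ eq))
  adj (inj₂ (inj₂ (eq , a≢b))) = inj₂ (inj₂ (cong (mod₄ ∘ toℕ) eq , a≢b))

  next≢ : ∀ i → next i ≢ i
  next≢ = from-yes (Fin.all? λ i → ¬? (next i Fin.≟ i))

  next²≢ : ∀ i → next (next i) ≢ i
  next²≢ = from-yes (Fin.all? λ i → ¬? (next (next i) Fin.≟ i))

  up≢same : ∀ {i j} → i ≡ suc j → mod₄ i ≢ mod₄ j
  up≢same refl = next≢ _

  up≢down : ∀ {i j l} → j ≡ suc i → i ≡ suc l → mod₄ j ≢ mod₄ l
  up≢down refl refl = next²≢ _

  sameRung : ∀ {v w : Fin n × Fin 2} → toℕ (proj₁ v) ≡ toℕ (proj₁ w) → v ≢ w → to v ≢ to w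
  sameRung i≡j v≢w eq = v≢w (cong₂ _,_ (toℕ-injective i≡j) (cong proj₂ eq))

  complement-unique : ∀ (a b c : Fin 2) → a ≢ b → a ≢ c → b ≡ c
  complement-unique 0F 0F _  a≢b _   = contradiction refl a≢b
  complement-unique 0F 1F 0F _   a≢c = contradiction refl a≢c
  complement-unique 0F 1F 1F _   _   = refl
  complement-unique 1F 0F 0F _   _   = refl
  complement-unique 1F 0F 1F _   a≢c = contradiction refl a≢c
  complement-unique 1F 1F _  a≢b _   = contradiction refl a≢b

  injective : ∀ {u v w} → DLAdj n u v → DLAdj n u w → v ≢ w → to v ≢ to w
  injective (inj₁ p)        (inj₁ q)        v≢w = sameRung (trans p (sym q)) v≢w
  injective (inj₁ p)        (inj₂ (inj₁ q)) _   = up≢down p q ∘ cong proj₁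
  injective (inj₁ p)        (inj₂ (inj₂ (refl , _))) _ = up≢same p ∘ cong proj₁
  injective (inj₂ (inj₁ p)) (inj₁ q)        _   = up≢down q p ∘ sym ∘ cong proj₁
  injective (inj₂ (inj₁ p)) (inj₂ (inj₁ q)) v≢w = sameRung (suc-injective (trans (sym p) q)) v≢w
  injective (inj₂ (inj₁ p)) (inj₂ (inj₂ (refl , _))) _ = up≢same p ∘ sym ∘ cong proj₁
  injective (inj₂ (inj₂ (refl , _))) (inj₁ q)        _ = up≢same q ∘ sym ∘ cong proj₁
  injective (inj₂ (inj₂ (refl , _))) (inj₂ (inj₁ q)) _ = up≢same q ∘ cong proj₁
  -- A vertex has a single neighbor in its own rung, so this case is impossible.
  injective (inj₂ (inj₂ (refl , a≢b))) (inj₂ (inj₂ (refl , a≢c))) v≢w =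
    contradiction (cong (_ ,_) (complement-unique _ _ _ a≢b a≢c)) v≢w

DL-9-colorable : ∀ n → HasGracefulColoring (DL n) 9
DL-9-colorable n = let f , c = C₄⊠K₂-colorable in _ , pullback (DL-cover n) f c

-- Color conditions around a vertex.

-- The entry ∣ a - a ∣ = 0 makes this say also that a does not occur in bs.
Spread : ℕ → List ℕ → Set
Spread a bs = Unique (map (∣ a -_∣) (a ∷ bs))

spread? : ∀ a bs → Dec (Spread a bs)
spread? a bs = DecUnique.unique? _≟_ _

-- Properness keeps the differences to neighbors away from the leading 0, and `edgeProper` keeps
-- them apart from each other.
neighbors-spread : ∀ {G k f} → IsGracefulColoring G k f → ∀ u vs →
                   All (Adj G u) vs → Unique vs → Spread (f u) (map f vs)
neighbors-spread {G} {f = f} c u vs uvs vs! = nonzero vs uvs ∷ distinct vs uvs vs!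
  where
  open IsGracefulColoring c

  nonzero : ∀ vs → All (Adj G u) vs → All (∣ f u - f u ∣ ≢_) (map (∣ f u -_∣) (map f vs))
  nonzero []       []         = []
  nonzero (v ∷ vs) (uv ∷ uvs) =
    (λ eq → proper u v uv (∣m-n∣≡0⇒m≡n (trans (sym eq) (∣n-n∣≡0 (f u))))) ∷ nonzero vs uvs

  distinct : ∀ vs → All (Adj G u) vs → Unique vs → Unique (map (∣ f u -_∣) (map f vs))
  distinct []       []         []         = []
  distinct (v ∷ vs) (uv ∷ uvs) (v∉ ∷ vs!) =
    All.map⁺ (All.map⁺ (All.zipWith (λ (uw , v≢w) → edgeProper u v _ uv uw v≢w) (uvs , v∉)))
      ∷ distinct vs uvs vs!

-- Exhaustive search over sorted rungs.

∀Color : ℕ → (ℕ → Set) → Set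
∀Color k P = ∀ a → 1 ≤ a → a ≤ k → P a

∀Color? : ∀ {P} → Decidable P → ∀ k → Dec (∀Color k P)
∀Color? P? zero    = yes λ { (suc _) _ () }
∀Color? P? (suc k) = map′
  (λ { (p , ps) a 1≤a a≤1+k → [ ps a 1≤a ∘ s≤s⁻¹ , (λ { refl → p }) ]′ (m≤n⇒m<n∨m≡n a≤1+k) })
  (λ ps → ps (suc k) (s≤s z≤n) ≤-refl , λ a 1≤a a≤k → ps a 1≤a (m≤n⇒m≤1+n a≤k))
  (P? (suc k) ×-dec ∀Color? P? k)

-- Two rungs colored p < p′ and q < q′ cannot be followed by m more.  The premises on
-- partial neighborhoods are implied by the later ones; they prune the search.
Stuck : ℕ → ℕ → (p p′ q q′ : ℕ) → Set
Stuck k zero    p p′ q q′ = ⊥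
Stuck k (suc m) p p′ q q′ =
  Spread q (q′ ∷ p ∷ p′ ∷ []) → Spread q′ (q ∷ p ∷ p′ ∷ []) → ∀Color k λ r →
  Spread q (r ∷ q′ ∷ p ∷ p′ ∷ []) → Spread q′ (r ∷ q ∷ p ∷ p′ ∷ []) → ∀Color k λ r′ → r < r′ →
  Spread q (r′ ∷ r ∷ q′ ∷ p ∷ p′ ∷ []) → Spread q′ (r′ ∷ r ∷ q ∷ p ∷ p′ ∷ []) →
  Stuck k m q q′ r r′

stuck? : ∀ k m p p′ q q′ → Dec (Stuck k m p p′ q q′)
stuck? k zero    p p′ q q′ = no λ ()
stuck? k (suc m) p p′ q q′ =
  spread? q (q′ ∷ p ∷ p′ ∷ []) →-dec (spread? q′ (q ∷ p ∷ p′ ∷ []) →-dec ∀Color? (λ r →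
  spread? q (r ∷ q′ ∷ p ∷ p′ ∷ []) →-dec (spread? q′ (r ∷ q ∷ p ∷ p′ ∷ []) →-dec ∀Color? (λ r′ → r <? r′ →-dec
  (spread? q (r′ ∷ r ∷ q′ ∷ p ∷ p′ ∷ []) →-dec (spread? q′ (r′ ∷ r ∷ q ∷ p ∷ p′ ∷ []) →-dec
  stuck? k m q q′ r r′))) k)) k)

AllStuck : ℕ → ℕ → Set
AllStuck k m = ∀Color k λ p → ∀Color k λ p′ → p < p′ → ∀Color k λ q → ∀Color k λ q′ → q < q′ →
  Stuck k m p p′ q q′

allStuck? : ∀ k m → Dec (AllStuck k m)
allStuck? k m =
  ∀Color? (λ p → ∀Color? (λ p′ → p <? p′ →-dec ∀Color? (λ q → ∀Color? (λ q′ → q <? q′ →-dec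
  stuck? k m p p′ q q′) k) k) k) k

-- Induction on `m`: the third rung of the coloring is fed to `Stuck`, with the conditions at the
-- second rung; then the first rung is dropped and the window of two rungs moves on.
stuck⇒¬coloring : ∀ {k} m f → IsGracefulColoring (DL (2 + m)) k f → Sorted f →
                  ¬ Stuck k m (f (0F , 0F)) (f (0F , 1F)) (f (1F , 0F)) (f (1F , 1F))
stuck⇒¬coloring zero    f c sorted stuck = stuck
stuck⇒¬coloring (suc m) f c sorted stuck =
  stuck⇒¬coloring m (f ∘ LocallyInjectiveHom.to (DL-suc (2 + m))) (pullback (DL-suc (2 + m)) f c)
    (sorted ∘ suc) (stuck
      (spread y  (y′ ∷ x ∷ x′ ∷ []))
      (spread y′ (y  ∷ x ∷ x′ ∷ []))
      (f z) (proj₁ (range z)) (proj₂ (range z))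
      (spread y  (z ∷ y′ ∷ x ∷ x′ ∷ []))
      (spread y′ (z ∷ y  ∷ x ∷ x′ ∷ []))
      (f z′) (proj₁ (range z′)) (proj₂ (range z′)) (sorted 2F)
      (spread y  (z′ ∷ z ∷ y′ ∷ x ∷ x′ ∷ []))
      (spread y′ (z′ ∷ z ∷ y  ∷ x ∷ x′ ∷ [])))
  where
  open IsGracefulColoring c
  open DecUnique (_≟V_ {3 + m}) using (unique?)

  -- The vertices involved are concrete whatever `m` is, so adjacency and distinctness are settled
  -- by evaluation.
  spread : ∀ u vs {adj : True (All.all? (DLAdj? u) vs)} {vs! : True (unique? vs)} →
           Spread (f u) (map f vs)
  spread u vs {adj} {vs!} = neighbors-spread c u vs (toWitness adj) (toWitness vs!)

  x x′ y y′ z z′ : Fin (3 + m) × Fin 2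
  x  = 0F , 0F
  x′ = 0F , 1F
  y  = 1F , 0F
  y′ = 1F , 1F
  z  = 2F , 0F
  z′ = 2F , 1F

allStuck⇒¬colorable : ∀ {k m} → AllStuck k m → ¬ HasGracefulColoring (DL (2 + m)) k
allStuck⇒¬colorable {k} {m} stuck col =
  stuck⇒¬coloring m f c sorted
    (at (1F , 1F) (at (1F , 0F) (at (0F , 1F) (at (0F , 0F) stuck) (sorted 0F))) (sorted 1F))
  where
  sortedCol = sort col
  f = proj₁ sortedCol
  c = proj₁ (proj₂ sortedCol)
  sorted = proj₂ (proj₂ sortedCol)

  at : ∀ {P : ℕ → Set} v → ∀Color k P → P (f v)
  at v p = let l , u = IsGracefulColoring.range c v in p (f v) l u

-- The search runs during type checking; its second argument counts the rungs after the first two.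
DL₅-not-7-colorable : ¬ HasGracefulColoring (DL 5) 7
DL₅-not-7-colorable = allStuck⇒¬colorable (toWitness {a? = allStuck? 7 3} _)

DL₇-not-8-colorable : ¬ HasGracefulColoring (DL 7) 8
DL₇-not-8-colorable = allStuck⇒¬colorable (toWitness {a? = allStuck? 8 5} _)

-- The graceful chromatic numbers.

restrict : ∀ {m n k} → m ≤ n → HasGracefulColoring (DL n) k → HasGracefulColoring (DL m) k
restrict m≤n (f , c) = _ , pullback (DL-≤ m≤n) f c

-- One refutation on a shorter ladder covers all smaller `j`: a coloring of `DL n` with `j < suc k`
-- colors restricts to `DL m` and weakens to `k` colors.
chromaticNumber : ∀ {m n k} → 2 ≤ suc k → m ≤ n → HasGracefulColoring (DL n) (suc k) →
                  ¬ HasGracefulColoring (DL m) k → GracefulChromaticNumber (DL n) (suc k)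
chromaticNumber 2≤ m≤n col ¬col =
  2≤ , col , λ j j<k col′ → ¬col (weaken (s≤s⁻¹ j<k) (restrict m≤n col′))

theorem3p7 : (∀ n → (n ≡ 5 ⊎ n ≡ 6) → GracefulChromaticNumber (DL n) 8)
    × (∀ n → 7 ≤ n → GracefulChromaticNumber (DL n) 9)
theorem3p7 =
  (λ where
    _ (inj₁ refl) → chromaticNumber 2≤ (from-yes (5 ≤? 5)) (restrict (from-yes (5 ≤? 6)) DL₆-colorable)
                      DL₅-not-7-colorable
    _ (inj₂ refl) → chromaticNumber 2≤ (from-yes (5 ≤? 6)) DL₆-colorable DL₅-not-7-colorable) ,
  λ n 7≤n → chromaticNumber 2≤ 7≤n (DL-9-colorable n) DL₇-not-8-colorable
  where
  2≤ : ∀ {k} → 2 ≤ 2 + k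
  2≤ = s≤s (s≤s z≤n)
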